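{- Let $n\ge 3$ be an odd number. Then the set of all $\mathcal{P}$-positions of the $n$-dimensional Wythoff's game with move vectors \[V=\{(1,0,\dots,0),(0,1,\dots,0),\dots,(0,0,\dots,1),(1,1,\dots,1)\}\] (the $n$ standard basis vectors together with the all-ones vector) is \[P^{(n)}=\{(x_1,x_2,\dots,x_n)\in\mathbb{N}^n : x_1\oplus x_2\oplus\dots\oplus x_n=0\}.\]
   Context: $\mathbb{N}$ denotes the non-negative integers, and $\oplus$ denotes the bitwise exclusive OR (Nim-sum) of non-negative integers. The $n$-dimensional Wythoff's game with a set of move vectors $V\subset\mathbb{N}^n\setminus\{\mathbf{0}\}$ is the following two-player game. A position is a tuple $x=(x_1,\dots,x_n)\in\mathbb{N}^n$ (the numbers of tokens in $n$ heaps). The players move alternately; from position $x$ the player in turn chooses $v\in V$ and an integer $k\ge 1$ with $x-kv\in\mathbb{N}^n$ and moves to $x-kv$. The player in turn who has no legal move loses. A position is an $\mathcal{N}$-position if the player about to move from it has a winning strategy; it is a $\mathcal{P}$-position if the other player (who moves second from it) has a winning strategy whatever the first player does. Equivalently, a position is a $\mathcal{P}$-position if and only if no legal move from it leads to a $\mathcal{P}$-position. -}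

module Defs where

open import Data.Digit using (Bit; 0b; 1b; toDigits; fromDigits)
open import Data.Fin.Base using (Fin; zero; suc)
open import Data.List.Base using (alignWith)
open import Data.Nat.Base using (ℕ; suc; _+_; _*_; _≥_; NonZero)
open import Data.Product.Base using (∃-syntax; _×_; proj₁)
open import Data.These.Base using (These; this; that; these)
open import Data.Vec.Base using (Vec; map; zipWith; replicate; foldr′; _[_]≔_)
open import Data.Vec.Properties using (∷-injectiveʳ)
open import Level using (0ℓ)
open import Relation.Binary.PropositionalEquality using (_≡_; refl)
open import Relation.Nullary using (¬_)
open import Relation.Unary using (Pred; _∈_)

xorBit : Bit → Bit → Bit
xorBit zero       b          = b
xorBit (suc zero) zero       = 1b
xorBit (suc zero) (suc zero) = 0b

-- `toDigits` lists bits starting from the least significant one, so `alignWith`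
-- pairs bits of equal weight; the surplus bits of the longer expansion are
-- xor-ed with 0.
infixl 6 _⊕_
_⊕_ : ℕ → ℕ → ℕ
m ⊕ n = fromDigits (alignWith xorThese (proj₁ (toDigits 2 m)) (proj₁ (toDigits 2 n)))
  where
  xorThese : These Bit Bit → Bit
  xorThese (this b)    = b
  xorThese (that c)    = c
  xorThese (these b c) = xorBit b c

nimSum : ∀ {n} → Vec ℕ n → ℕ
nimSum = foldr′ _⊕_ 0

module Game {n : ℕ} (V : Pred (Vec ℕ n) 0ℓ) where

  Position : Set
  Position = Vec ℕ n

  -- The move from x to x − kv, written as y + kv = x: this says both that
  -- x − kv has no negative entries and that it equals y.
  Move : Position → Position → Set
  Move x y = ∃[ v ] ∃[ k ] v ∈ V × k ≥ 1 × zipWith _+_ y (map (k *_) v) ≡ x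

  -- An element is a winning strategy, for the player about to move (𝒩) or for
  -- the other player (𝒫). Strategies are well-founded, so plays following them
  -- end; a player with no move loses, by `respond` with no cases.
  mutual
    data 𝒩-position (x : Position) : Set where
      choose : ∀ y → Move x y → 𝒫-position y → 𝒩-position x

    data 𝒫-position (x : Position) : Set where
      respond : (∀ y → Move x y → 𝒩-position y) → 𝒫-position x

open Game public

data Vectors (n : ℕ) : Pred (Vec ℕ n) 0ℓ where
  basis : (i : Fin n) → Vectors n (replicate n 0 [ i ]≔ 1)
  ones  : Vectors n (replicate n 1)

0∉Vectors : ∀ {n} .{{_ : NonZero n}} → ¬ (replicate n 0 ∈ Vectors n)
0∉Vectors {n} 0∈V = go 0∈V refl
  where
  basis≢0 : ∀ {n} (i : Fin n) → ¬ (replicate n 0 [ i ]≔ 1 ≡ replicate n 0)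
  basis≢0 zero    ()
  basis≢0 {suc n} (suc i) eq = basis≢0 i (∷-injectiveʳ eq)
  ones≢0 : ∀ {n} .{{_ : NonZero n}} → ¬ (replicate n 1 ≡ replicate n 0)
  ones≢0 {suc n} ()
  go : ∀ {v} → Vectors n v → ¬ (v ≡ replicate n 0)
  go (basis i) = basis≢0 i
  go ones      = ones≢0

P⁽_⁾ : (n : ℕ) → Pred (Vec ℕ n) 0ℓ
P⁽ n ⁾ x = nimSum x ≡ 0

module Submission where

-- Write x = y + kv for a move between positions of Nim-sum 0. If v is a basis vector, x and y differ
-- in one entry only, which the Nim-sum detects. If v is the all-ones vector, adding k keeps
-- the bits below the lowest set bit of k and flips that bit in each of the n entries; since n is odd,
-- that bit of the Nim-sum is flipped as well. So no move joins two positions of Nim-sum 0,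
-- while the usual Nim move leads from any other position to one of Nim-sum 0.

open import Defs
open import Data.Digit using (Bit; toDigits; fromDigits)
open import Data.Empty using (⊥; ⊥-elim)
open import Data.Fin.Base using (Fin; zero; suc; toℕ)
open import Data.List.Base as List using (List; []; _∷_; alignWith)
import Data.List.Properties as List
open import Data.Nat using (ℕ; zero; suc; _+_; _*_; _∸_; _<_; _≥_; _≟_; _%_; NonZero; 2+; parity; ⌊_/2⌋; z<s; s<s; s<s⁻¹)
open import Data.Nat.Induction using (<-rec)
open import Data.Nat.Properties
open import Data.Parity.Base as ℙ using (Parity; 0ℙ; 1ℙ)
import Data.Parity.Properties as ℙ
open import Data.Product.Base using (∃-syntax; _×_; _,_; proj₁; proj₂)
open import Data.These.Base using (These; this; that; these)
open import Data.Vec.Base using (Vec; []; _∷_; lookup; map; replicate; sum; zipWith; _[_]≔_; _[_]%=_)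
open import Data.Vec.Properties using (map-replicate; updateAt-id-local; updateAt-updateAt; zipWith-identityʳ; zipWith-replicate₂)
open import Function.Base using (_∘_)
open import Relation.Binary.PropositionalEquality
open import Relation.Nullary using (yes; no)
open import Relation.Nullary.Decidable using (decidable-stable)
open import Relation.Unary using (_≐_; _∈_)

-- Binary expansions

-- Induction on the binary expansion: halving drops the lowest bit and strictly decreases a positive
-- number.
half-rec : (P : ℕ → Set) → P 0 → (∀ n → P ⌊ suc n /2⌋ → P (suc n)) → ∀ n → P n
half-rec P p₀ step = <-rec P λ where
  zero    _   → p₀
  (suc n) rec → step n (rec (⌊n/2⌋<n n))

-- Bits live in `Parity` because addition there is exclusive or, so the group laws of ℤ/2 apply to
-- them.
bit : ℕ → ℕ → Parity
bit zero    m = parity m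
bit (suc j) m = bit j ⌊ m /2⌋

bit-0 : ∀ j → bit j 0 ≡ 0ℙ
bit-0 zero    = refl
bit-0 (suc j) = bit-0 j

parity-half-injective : ∀ m n → parity m ≡ parity n → ⌊ m /2⌋ ≡ ⌊ n /2⌋ → m ≡ n
parity-half-injective 0             0             _ _ = refl
parity-half-injective 1             1             _ _ = refl
parity-half-injective (suc (suc m)) (suc (suc n)) p h =
  cong 2+ (parity-half-injective m n p (suc-injective h))
parity-half-injective 0             1             () _
parity-half-injective 1             0             () _
parity-half-injective 0             (suc (suc n)) _ ()
parity-half-injective 1             (suc (suc n)) _ ()
parity-half-injective (suc (suc m)) 0             _ ()
parity-half-injective (suc (suc m)) 1             _ ()

bits≡0⇒≡0 : ∀ m → (∀ j → bit j m ≡ 0ℙ) → m ≡ 0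
bits≡0⇒≡0 = half-rec (λ m → (∀ j → bit j m ≡ 0ℙ) → m ≡ 0) (λ _ → refl) λ n rec bits →
  parity-half-injective (suc n) 0 (bits 0) (rec (bits ∘ suc))

bit-injective : ∀ m n → (∀ j → bit j m ≡ bit j n) → m ≡ n
bit-injective = half-rec (λ m → ∀ n → (∀ j → bit j m ≡ bit j n) → m ≡ n)
  (λ n bits → sym (bits≡0⇒≡0 n λ j → trans (sym (bits j)) (bit-0 j)))
  (λ m rec n bits → parity-half-injective (suc m) n (bits 0) (rec ⌊ n /2⌋ (bits ∘ suc)))

-- If the half is zero, the number is 1 and its top bit is bit 0; otherwise the top bit of the half
-- moves up one place.
highest-bit : ∀ m → m ≢ 0 → ∃[ j ] bit j m ≡ 1ℙ × (∀ i → j < i → bit i m ≡ 0ℙ)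
highest-bit = half-rec P (λ 0≢0 → ⊥-elim (0≢0 refl)) step
  where
  P : ℕ → Set
  P m = m ≢ 0 → ∃[ j ] bit j m ≡ 1ℙ × (∀ i → j < i → bit i m ≡ 0ℙ)
  step : ∀ n → P ⌊ suc n /2⌋ → P (suc n)
  step n rec _ with ⌊ suc n /2⌋ ≟ 0 | parity (suc n) in p
  ... | yes h | 0ℙ = ⊥-elim (1+n≢0 (parity-half-injective (suc n) 0 p h))
  ... | yes h | 1ℙ = 0 , p , λ { (suc i) _ → trans (cong (bit i) h) (bit-0 i) }
  ... | no h  | _  with j , bⱼ , above ← rec h =
    suc j , bⱼ , λ { (suc i) j<i → above i (s<s⁻¹ j<i) }

odd-half≡⇒< : ∀ m n → parity m ≡ 1ℙ → parity n ≡ 0ℙ → ⌊ m /2⌋ ≡ ⌊ n /2⌋ → n < m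
odd-half≡⇒< 1             0             _ _ _ = z<s
odd-half≡⇒< (suc (suc m)) (suc (suc n)) p q h = s<s (s<s (odd-half≡⇒< m n p q (suc-injective h)))
odd-half≡⇒< 1             (suc (suc n)) _ _ ()
odd-half≡⇒< (suc (suc m)) 0             _ _ ()

higher-bit⇒< : ∀ j m n → bit j m ≡ 1ℙ → bit j n ≡ 0ℙ → (∀ i → j < i → bit i m ≡ bit i n) → n < m
higher-bit⇒< zero    m n p q above =
  odd-half≡⇒< m n p q (bit-injective ⌊ m /2⌋ ⌊ n /2⌋ λ i → above (suc i) z<s)
-- The halves satisfy the hypotheses at `j`, and halving is monotone, so `m ≤ n` would contradict
-- their strict order.
higher-bit⇒< (suc j) m n p q above = ≰⇒> λ m≤n → <⇒≱
  (higher-bit⇒< j ⌊ m /2⌋ ⌊ n /2⌋ p q λ i j<i → above (suc i) (s<s j<i))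
  (⌊n/2⌋-mono m≤n)

⌊1+even/2⌋ : ∀ k → parity k ≡ 0ℙ → ⌊ suc k /2⌋ ≡ ⌊ k /2⌋
⌊1+even/2⌋ 0             _ = refl
⌊1+even/2⌋ (suc (suc k)) p = cong suc (⌊1+even/2⌋ k p)

⌊+even/2⌋ : ∀ m k → parity k ≡ 0ℙ → ⌊ m + k /2⌋ ≡ ⌊ m /2⌋ + ⌊ k /2⌋
⌊+even/2⌋ 0             k p = refl
⌊+even/2⌋ 1             k p = ⌊1+even/2⌋ k p
⌊+even/2⌋ (suc (suc m)) k p = cong suc (⌊+even/2⌋ m k p)

-- The witness is the position of the lowest set bit of `k`: below it `k` is zero, so no carry
-- arrives there. It is chosen before `m`, so one position serves all heaps at once.
+-flips-bit : ∀ k → k ≢ 0 → ∃[ j ] ∀ m → bit j (m + k) ≡ 1ℙ ℙ.+ bit j m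
+-flips-bit = half-rec P (λ 0≢0 → ⊥-elim (0≢0 refl)) step
  where
  P : ℕ → Set
  P k = k ≢ 0 → ∃[ j ] ∀ m → bit j (m + k) ≡ 1ℙ ℙ.+ bit j m
  step : ∀ n → P ⌊ suc n /2⌋ → P (suc n)
  step n rec _ with parity (suc n) in p
  ... | 1ℙ = 0 , λ m → trans (ℙ.+-homo-+ m (suc n))
                         (trans (cong (parity m ℙ.+_) p) (ℙ.+-comm (parity m) 1ℙ))
  ... | 0ℙ with j , flip ← rec (λ h → 1+n≢0 (parity-half-injective (suc n) 0 p h)) =
    suc j , λ m → trans (cong (bit j) (⌊+even/2⌋ m (suc n) p)) (flip ⌊ m /2⌋)

%2≡1⇒odd : ∀ n → n % 2 ≡ 1 → parity n ≡ 1ℙ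
%2≡1⇒odd 1             _ = refl
%2≡1⇒odd (suc (suc n)) p = %2≡1⇒odd n p

-- Bits of Nim-sums

-- Positions past the end read `0ℙ`, in agreement with the leading zeros seen by `bit`; lists of
-- different lengths then need no padding.
digit : ℕ → List Bit → Parity
digit j       []       = 0ℙ
digit zero    (d ∷ ds) = parity (toℕ d)
digit (suc j) (d ∷ ds) = digit j ds

parity-digit+*2 : ∀ (d : Bit) m → parity (toℕ d + m * 2) ≡ parity (toℕ d)
parity-digit+*2 zero       zero    = refl
parity-digit+*2 zero       (suc m) = parity-digit+*2 zero m
parity-digit+*2 (suc zero) zero    = refl
parity-digit+*2 (suc zero) (suc m) = parity-digit+*2 (suc zero) m

⌊digit+*2/2⌋ : ∀ (d : Bit) m → ⌊ toℕ d + m * 2 /2⌋ ≡ m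
⌊digit+*2/2⌋ zero       zero    = refl
⌊digit+*2/2⌋ zero       (suc m) = cong suc (⌊digit+*2/2⌋ zero m)
⌊digit+*2/2⌋ (suc zero) zero    = refl
⌊digit+*2/2⌋ (suc zero) (suc m) = cong suc (⌊digit+*2/2⌋ (suc zero) m)

bit-fromDigits : ∀ j ds → bit j (fromDigits ds) ≡ digit j ds
bit-fromDigits j       []       = bit-0 j
bit-fromDigits zero    (d ∷ ds) = parity-digit+*2 d (fromDigits ds)
bit-fromDigits (suc j) (d ∷ ds) =
  trans (cong (bit j) (⌊digit+*2/2⌋ d (fromDigits ds))) (bit-fromDigits j ds)

parity-xorBit : ∀ b c → parity (toℕ (xorBit b c)) ≡ parity (toℕ b) ℙ.+ parity (toℕ c)
parity-xorBit zero       c          = refl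
parity-xorBit (suc zero) zero       = refl
parity-xorBit (suc zero) (suc zero) = refl

-- The function aligned in the definition of _⊕_ is local to it, hence the abstract f.
digit-alignWith : (f : These Bit Bit → Bit) →
                  (∀ b → f (this b) ≡ b) → (∀ c → f (that c) ≡ c) → (∀ b c → f (these b c) ≡ xorBit b c) →
                  ∀ j bs cs → digit j (alignWith f bs cs) ≡ digit j bs ℙ.+ digit j cs
digit-alignWith f f-this f-that f-these = go
  where
  go : ∀ j bs cs → digit j (alignWith f bs cs) ≡ digit j bs ℙ.+ digit j cs
  go j []       cs = cong (digit j) (trans (List.map-cong f-that cs) (List.map-id cs))
  go j (b ∷ bs) [] = trans
    (cong (digit j) (trans (List.map-cong f-this (b ∷ bs)) (List.map-id (b ∷ bs))))
    (sym (ℙ.+-identityʳ (digit j (b ∷ bs))))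
  go zero    (b ∷ bs) (c ∷ cs) = trans (cong (parity ∘ toℕ) (f-these b c)) (parity-xorBit b c)
  go (suc j) (b ∷ bs) (c ∷ cs) = go j bs cs

bit-⊕ : ∀ j m n → bit j (m ⊕ n) ≡ bit j m ℙ.+ bit j n
bit-⊕ j m n = begin
  bit j (m ⊕ n)              ≡⟨ trans (bit-fromDigits j (alignWith _ ms ns))
                                      -- Unification finds the local function, whose three defining
                                      -- clauses hold by computation.
                                      (digit-alignWith _ (λ _ → refl) (λ _ → refl) (λ _ _ → refl) j ms ns) ⟩
  digit j ms ℙ.+ digit j ns  ≡⟨ cong₂ ℙ._+_ (digit-toDigits m) (digit-toDigits n) ⟩
  bit j m ℙ.+ bit j n        ∎
  where
  open ≡-Reasoning
  ms = proj₁ (toDigits 2 m)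
  ns = proj₁ (toDigits 2 n)
  digit-toDigits : ∀ m → digit j (proj₁ (toDigits 2 m)) ≡ bit j m
  digit-toDigits m with ds , eq ← toDigits 2 m = trans (sym (bit-fromDigits j ds)) (cong (bit j) eq)

bitSum : ∀ {n} → ℕ → Vec ℕ n → Parity
bitSum j []       = 0ℙ
bitSum j (m ∷ xs) = bit j m ℙ.+ bitSum j xs

bit-nimSum : ∀ {n} j (xs : Vec ℕ n) → bit j (nimSum xs) ≡ bitSum j xs
bit-nimSum j []       = bit-0 j
bit-nimSum j (m ∷ xs) = trans (bit-⊕ j m (nimSum xs)) (cong (bit j m ℙ.+_) (bit-nimSum j xs))

nimSum≡0⇒bitSum≡0 : ∀ {n} j (xs : Vec ℕ n) → nimSum xs ≡ 0 → bitSum j xs ≡ 0ℙ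
nimSum≡0⇒bitSum≡0 j xs eq = trans (sym (bit-nimSum j xs)) (trans (cong (bit j) eq) (bit-0 j))

-- In ℤ/2 adding the old bit once more cancels it, after which the new one is added.
bitSum-updateAt : ∀ {n} j (xs : Vec ℕ n) i f →
                  bitSum j (xs [ i ]%= f) ≡ bitSum j xs ℙ.+ (bit j (lookup xs i) ℙ.+ bit j (f (lookup xs i)))
bitSum-updateAt j (m ∷ xs) zero f = swap (bit j m) (bit j (f m)) (bitSum j xs)
  where
  swap : ∀ p q s → q ℙ.+ s ≡ (p ℙ.+ s) ℙ.+ (p ℙ.+ q)
  swap 0ℙ q  s  = ℙ.+-comm q s
  swap 1ℙ 0ℙ 0ℙ = refl
  swap 1ℙ 0ℙ 1ℙ = refl
  swap 1ℙ 1ℙ 0ℙ = refl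
  swap 1ℙ 1ℙ 1ℙ = refl
bitSum-updateAt j (m ∷ xs) (suc i) f = trans
  (cong (bit j m ℙ.+_) (bitSum-updateAt j xs i f))
  (sym (ℙ.+-assoc (bit j m) (bitSum j xs) _))

-- Each entry contributes one extra `1ℙ`, and `n` of these add up to `parity n`. This is how the
-- parity of the number of heaps enters.
bitSum-flip : ∀ {n} j (f : ℕ → ℕ) → (∀ m → bit j (f m) ≡ 1ℙ ℙ.+ bit j m) →
              (xs : Vec ℕ n) → bitSum j (map f xs) ≡ parity n ℙ.+ bitSum j xs
bitSum-flip         j f flip []       = refl
bitSum-flip {suc n} j f flip (m ∷ xs) = begin
  bit j (f m) ℙ.+ bitSum j (map f xs)             ≡⟨ cong₂ ℙ._+_ (flip m) (bitSum-flip j f flip xs) ⟩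
  (1ℙ ℙ.+ bit j m) ℙ.+ (parity n ℙ.+ bitSum j xs) ≡⟨ interchange 1ℙ (bit j m) (parity n) (bitSum j xs) ⟩
  (1ℙ ℙ.+ parity n) ℙ.+ (bit j m ℙ.+ bitSum j xs) ≡⟨ cong (ℙ._+ bitSum j (m ∷ xs)) (ℙ.+-homo-+ 1 n) ⟨
  parity (suc n) ℙ.+ bitSum j (m ∷ xs)            ∎
  where
  open ≡-Reasoning
  open import Algebra.Properties.CommutativeSemigroup ℙ.+-commutativeSemigroup using (interchange)

-- A sum of zeros is zero, so some entry has the bit set; this finds the heap to play in.
bitSum≡1⇒∃bit≡1 : ∀ {n} j (xs : Vec ℕ n) → bitSum j xs ≡ 1ℙ → ∃[ i ] bit j (lookup xs i) ≡ 1ℙ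
bitSum≡1⇒∃bit≡1 j (m ∷ xs) eq with bit j m in b
... | 1ℙ = zero , b
... | 0ℙ with i , c ← bitSum≡1⇒∃bit≡1 j xs eq = suc i , c

-- Moves

+basis : ∀ {n} k (xs : Vec ℕ n) i →
         zipWith _+_ xs (map (k *_) (replicate n 0 [ i ]≔ 1)) ≡ xs [ i ]%= (_+ k)
+basis {suc n} k (m ∷ xs) zero = cong₂ _∷_ (cong (m +_) (*-identityʳ k)) (begin
  zipWith _+_ xs (map (k *_) (replicate n 0)) ≡⟨ cong (zipWith _+_ xs) (map-replicate (k *_) 0 n) ⟩
  zipWith _+_ xs (replicate n (k * 0))        ≡⟨ cong (zipWith _+_ xs ∘ replicate n) (*-zeroʳ k) ⟩
  zipWith _+_ xs (replicate n 0)              ≡⟨ zipWith-identityʳ +-identityʳ xs ⟩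
  xs                                          ∎)
  where open ≡-Reasoning
+basis k (m ∷ xs) (suc i) =
  cong₂ _∷_ (trans (cong (m +_) (*-zeroʳ k)) (+-identityʳ m)) (+basis k xs i)

+ones : ∀ {n} k (xs : Vec ℕ n) → zipWith _+_ xs (map (k *_) (replicate n 1)) ≡ map (_+ k) xs
+ones {n} k xs = begin
  zipWith _+_ xs (map (k *_) (replicate n 1)) ≡⟨ cong (zipWith _+_ xs) (map-replicate (k *_) 1 n) ⟩
  zipWith _+_ xs (replicate n (k * 1))        ≡⟨ cong (zipWith _+_ xs ∘ replicate n) (*-identityʳ k) ⟩
  zipWith _+_ xs (replicate n k)              ≡⟨ zipWith-replicate₂ _+_ xs k ⟩
  map (_+ k) xs                               ∎
  where open ≡-Reasoning

sum-+* : ∀ {n} k (ys vs : Vec ℕ n) → sum (zipWith _+_ ys (map (k *_) vs)) ≡ sum ys + k * sum vs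
sum-+* k []       []       = sym (*-zeroʳ k)
sum-+* k (y ∷ ys) (v ∷ vs) = begin
  (y + k * v) + sum (zipWith _+_ ys (map (k *_) vs)) ≡⟨ cong ((y + k * v) +_) (sum-+* k ys vs) ⟩
  (y + k * v) + (sum ys + k * sum vs)                ≡⟨ interchange y (k * v) (sum ys) (k * sum vs) ⟩
  (y + sum ys) + (k * v + k * sum vs)                ≡⟨ cong (y + sum ys +_) (*-distribˡ-+ k v (sum vs)) ⟨
  (y + sum ys) + k * (v + sum vs)                    ∎
  where
  open ≡-Reasoning
  open import Algebra.Properties.CommutativeSemigroup +-commutativeSemigroup using (interchange)

sum-Vectors : ∀ {n} .{{_ : NonZero n}} {v} → v ∈ Vectors n → sum v ≥ 1
sum-Vectors         (basis i) = sum-basis i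
  where
  sum-basis : ∀ {n} (i : Fin n) → sum (replicate n 0 [ i ]≔ 1) ≥ 1
  sum-basis zero    = z<s
  sum-basis (suc i) = sum-basis i
sum-Vectors {suc n} ones      = z<s

-- The total number of tokens is the measure for the induction on positions: a move removes
-- `k * sum v` tokens, and both factors are positive.
Move⇒sum< : ∀ {n} .{{_ : NonZero n}} {x y} → Move (Vectors n) x y → sum y < sum x
Move⇒sum< {y = y} (v , k , v∈V , k≥1 , refl) =
  subst (sum y <_) (sym (sum-+* k y v)) (m<m+n (sum y) (*-mono-≤ k≥1 (sum-Vectors v∈V)))

-- Play the two strategies against each other: after one move the players swap roles, and the
-- well-foundedness of strategies ends the play.
𝒫∧𝒩⇒⊥ : ∀ {n V} {x : Vec ℕ n} → 𝒫-position V x → 𝒩-position V x → ⊥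
𝒫∧𝒩⇒⊥ (respond f) (choose y x→y p) = 𝒫∧𝒩⇒⊥ p (f y x→y)

-- Nim-sums along moves

nimSum-basis-move : ∀ {n} k (y : Vec ℕ n) i → k ≢ 0 → nimSum (y [ i ]%= (_+ k)) ≡ 0 → nimSum y ≢ 0
nimSum-basis-move k y i k≢0 x₀ y₀ = k≢0 (sym (+-cancelˡ-≡ m 0 k (trans (+-identityʳ m) m≡m+k)))
  where
  open ≡-Reasoning
  m = lookup y i
  m≡m+k : m ≡ m + k
  -- Both Nim-sums vanish, so the correction term of `bitSum-updateAt` is zero at every bit, and the
  -- old and new entries coincide.
  m≡m+k = bit-injective m (m + k) λ j → ℙ.+-cancelˡ-≡ (bit j m) _ _ (begin
    bit j m ℙ.+ bit j m                        ≡⟨ ℙ.p+p≡0ℙ (bit j m) ⟩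
    0ℙ                                         ≡⟨ nimSum≡0⇒bitSum≡0 j (y [ i ]%= (_+ k)) x₀ ⟨
    bitSum j (y [ i ]%= (_+ k))                ≡⟨ bitSum-updateAt j y i (_+ k) ⟩
    bitSum j y ℙ.+ (bit j m ℙ.+ bit j (m + k)) ≡⟨ cong (ℙ._+ (bit j m ℙ.+ bit j (m + k))) (nimSum≡0⇒bitSum≡0 j y y₀) ⟩
    bit j m ℙ.+ bit j (m + k)                  ∎)

nimSum-ones-move : ∀ {n} k (y : Vec ℕ n) → parity n ≡ 1ℙ → k ≢ 0 → nimSum (map (_+ k) y) ≡ 0 → nimSum y ≢ 0
nimSum-ones-move {n} k y odd k≢0 x₀ y₀ with j , flip ← +-flips-bit k k≢0 = ℙ.p≢p⁻¹ 0ℙ (begin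
  0ℙ                        ≡⟨ nimSum≡0⇒bitSum≡0 j (map (_+ k) y) x₀ ⟨
  bitSum j (map (_+ k) y)   ≡⟨ bitSum-flip j (_+ k) flip y ⟩
  parity n ℙ.+ bitSum j y   ≡⟨ cong₂ ℙ._+_ odd (nimSum≡0⇒bitSum≡0 j y y₀) ⟩
  1ℙ                        ∎)
  where open ≡-Reasoning

move-leaves-nimSum≡0 : ∀ {n} → parity n ≡ 1ℙ → ∀ {x y} → Move (Vectors n) x y → nimSum x ≡ 0 → nimSum y ≢ 0
move-leaves-nimSum≡0 odd {y = y} (_ , k , basis i , k≥1 , refl) x₀ =
  nimSum-basis-move k y i (m<n⇒n≢0 k≥1) (trans (sym (cong nimSum (+basis k y i))) x₀)
move-leaves-nimSum≡0 odd {y = y} (_ , k , ones , k≥1 , refl) x₀ =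
  nimSum-ones-move k y odd (m<n⇒n≢0 k≥1) (trans (sym (cong nimSum (+ones k y))) x₀)

decrease-move : ∀ {n} (x : Vec ℕ n) i {c} → c < lookup x i → Move (Vectors n) x (x [ i ]≔ c)
decrease-move x i {c} c<xᵢ = _ , k , basis i , m<n⇒0<n∸m c<xᵢ , (begin
  zipWith _+_ (x [ i ]≔ c) (map (k *_) (replicate _ 0 [ i ]≔ 1)) ≡⟨ +basis k (x [ i ]≔ c) i ⟩
  (x [ i ]≔ c) [ i ]%= (_+ k)                                    ≡⟨ updateAt-updateAt i x ⟩
  x [ i ]≔ (c + k)                                               ≡⟨ updateAt-id-local i x (m+[n∸m]≡n (<⇒≤ c<xᵢ)) ⟩
  x                                                              ∎)
  where
  open ≡-Reasoning
  k = lookup x i ∸ c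

-- The classical Nim move: a heap `m` containing the top bit of the Nim-sum `s` is lowered to
-- `m ⊕ s`, which adds `s` to the Nim-sum and so cancels it.
move-to-nimSum≡0 : ∀ {n} (x : Vec ℕ n) → nimSum x ≢ 0 → ∃[ y ] Move (Vectors n) x y × nimSum y ≡ 0
move-to-nimSum≡0 x s≢0
  with j , sⱼ≡1 , above ← highest-bit (nimSum x) s≢0
  with i , mⱼ≡1 ← bitSum≡1⇒∃bit≡1 j x (trans (sym (bit-nimSum j x)) sⱼ≡1)
  = x [ i ]≔ (m ⊕ s) , decrease-move x i m⊕s<m , bits≡0⇒≡0 _ λ l → begin
    bit l (nimSum (x [ i ]≔ (m ⊕ s)))                ≡⟨ bit-nimSum l (x [ i ]≔ (m ⊕ s)) ⟩
    bitSum l (x [ i ]≔ (m ⊕ s))                      ≡⟨ bitSum-updateAt l x i _ ⟩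
    bitSum l x ℙ.+ (bit l m ℙ.+ bit l (m ⊕ s))       ≡⟨ cong₂ (λ p q → p ℙ.+ (bit l m ℙ.+ q)) (sym (bit-nimSum l x)) (bit-⊕ l m s) ⟩
    bit l s ℙ.+ (bit l m ℙ.+ (bit l m ℙ.+ bit l s))  ≡⟨ cancel (bit l s) (bit l m) ⟩
    0ℙ                                               ∎
  where
  open ≡-Reasoning
  s = nimSum x
  m = lookup x i
  m⊕s<m : m ⊕ s < m
  -- Bit `j` drops from 1 to 0, and the bits above it stay, as `s` has none there.
  m⊕s<m = higher-bit⇒< j m (m ⊕ s) mⱼ≡1
    (trans (bit-⊕ j m s) (cong₂ ℙ._+_ mⱼ≡1 sⱼ≡1))
    (λ l j<l → sym (trans (bit-⊕ l m s) (trans (cong (bit l m ℙ.+_) (above l j<l)) (ℙ.+-identityʳ _))))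
  cancel : ∀ p q → p ℙ.+ (q ℙ.+ (q ℙ.+ p)) ≡ 0ℙ
  cancel p 0ℙ = ℙ.p+p≡0ℙ p
  cancel p 1ℙ = trans (cong (p ℙ.+_) (ℙ.⁻¹-involutive p)) (ℙ.p+p≡0ℙ p)

-- Characterisation of the 𝒫-positions

nimSum≡0⇒𝒫 : ∀ {n} .{{_ : NonZero n}} → parity n ≡ 1ℙ → (x : Vec ℕ n) → nimSum x ≡ 0 → 𝒫-position (Vectors n) x
nimSum≡0⇒𝒫 {n} odd x = <-rec (λ t → ∀ x → sum x ≡ t → nimSum x ≡ 0 → 𝒫-position (Vectors n) x) step (sum x) x refl
  where
  step : ∀ t → (∀ {u} → u < t → ∀ x → sum x ≡ u → nimSum x ≡ 0 → 𝒫-position (Vectors n) x) →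
         ∀ x → sum x ≡ t → nimSum x ≡ 0 → 𝒫-position (Vectors n) x
  -- Every move spoils the zero Nim-sum and the Nim move restores it, so the induction hypothesis
  -- applies two moves later.
  step t rec x refl x₀ = respond λ y x→y →
    let z , y→z , z₀ = move-to-nimSum≡0 y (move-leaves-nimSum≡0 odd x→y x₀)
    in choose z y→z (rec (<-trans (Move⇒sum< y→z) (Move⇒sum< x→y)) z refl z₀)

theorem3 : (n : ℕ) → n ≥ 3 → n % 2 ≡ 1 → 𝒫-position (Vectors n) ≐ P⁽ n ⁾
-- Matching on a successor makes the `NonZero n` instance available.
theorem3 n@(suc _) _ n%2≡1 = 𝒫⇒nimSum≡0 , λ {x} → nimSum≡0⇒𝒫 odd x
  where
  odd : parity n ≡ 1ℙ
  odd = %2≡1⇒odd n n%2≡1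
  𝒫⇒nimSum≡0 : ∀ {x} → 𝒫-position (Vectors n) x → nimSum x ≡ 0
  -- Equality with 0 is decidable, so contradiction suffices: a nonzero Nim-sum would also give the
  -- player to move a winning strategy.
  𝒫⇒nimSum≡0 {x} p = decidable-stable (nimSum x ≟ 0) λ s≢0 →
    let y , x→y , y₀ = move-to-nimSum≡0 x s≢0
    in 𝒫∧𝒩⇒⊥ p (choose y x→y (nimSum≡0⇒𝒫 odd y y₀))
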